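{- Let $\ell\ge3$. Suppose that $\lambda$ is an $(\ell,0)$-JM partition and $0\le i<\ell$. Write $\widehat\varphi=\widehat\varphi_i(\lambda)$ and $\widehat\varepsilon=\widehat\varepsilon_i(\lambda)$. Then 1. $\widehat f_i^{\,k}\lambda$ is not an $(\ell,0)$-JM partition for $0<k<\widehat\varphi-1$; 2. $\widehat e_i^{\,k}\lambda$ is not an $(\ell,0)$-JM partition for $1<k<\widehat\varepsilon$.
   Context: $h^\lambda_{(a,b)}$ is the hook length of the box in row $a$, column $b$: the number of boxes of $\lambda$ to the right of and below $(a,b)$ (same row or column), including $(a,b)$. A partition $\lambda$ is an $(\ell,0)$-JM partition if there do not exist boxes $(a,b),(a,y),(x,b)$ in its Young diagram with $\ell\mid h^\lambda_{(a,b)}$, $\ell\nmid h^\lambda_{(a,y)}$ and $\ell\nmid h^\lambda_{(x,b)}$. Ladder crystal operators. The position $(a,b)$ (row $a$, column $b$) has residue $b-a\bmod\ell$. The ladder of $(a,b)$ is the set of positions $(c,d)$, $c,d\ge1$, with $c-a=(\ell-1)(b-d)$; all its positions have the same residue, and it is an $i$-ladder if that residue is $i$. Ladders are ordered left to right, i.e. by increasing value of $a+(\ell-1)(b-1)$. A box of $\lambda$ of residue $i$ whose removal leaves a partition is a removable $i$-box; a position of residue $i$ not in $\lambda$ whose addition gives a partition is an addable $i$-box. Given a partition $\lambda$, label each addable $i$-box $+$ and each removable $i$-box $-$; the ladder $i$-signature is the word read from leftmost $i$-ladder to rightmost $i$-ladder, and from top to bottom on each ladder. Repeatedly cancel adjacent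 pairs $-+$ to get the reduced ladder $i$-signature $+\cdots+-\cdots-$. The number of remaining $+$'s is $\widehat\varphi_i(\lambda)$ and the number of remaining $-$'s is $\widehat\varepsilon_i(\lambda)$. $\widehat f_i\lambda$ is $\lambda$ together with the box of the rightmost remaining $+$ (or $0$ if there is none); $\widehat e_i\lambda$ is $\lambda$ with the box of the leftmost remaining $-$ removed (or $0$ if there is none). -}

module Defs where

open import Data.Empty using (⊥-elim)
import Data.Integer.Base as ℤ
open import Data.List.Base
  using (List; []; _∷_; length; map; filter; concatMap; mapMaybe; foldr;
         upTo; cartesianProduct; head; last)
open import Data.List.Membership.Propositional using () renaming (_∈_ to _∈ˡ_)
open import Data.List.Membership.Propositional.Properties
  using (∈-upTo⁺; ∈-cartesianProduct⁺; ∈-filter⁺; ∈-concatMap⁺)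
import Data.List.Relation.Unary.Any as AnyL
open import Data.Maybe.Base using (Maybe; just; nothing; _>>=_)
import Data.Maybe.Base as Maybe
open import Data.Nat.Base
open import Data.Nat.Divisibility using (_∣_)
open import Data.Nat.GeneralisedArithmetic using (fold)
open import Data.Nat.Properties
open import Data.Product.Base using (Σ; ∃; ∃-syntax; _×_; _,_; proj₁; proj₂)
open import Data.Sum.Base using (_⊎_; inj₁; inj₂)
open import Data.Unit.Base using (⊤; tt)
open import Function.Bundles using (_⇔_; mk⇔; Equivalence)
open import Relation.Binary.Construct.Closure.ReflexiveTransitive
  using (Star; ε; _◅_; _◅◅_; gmap)
open import Relation.Binary.PropositionalEquality
  using (_≡_; _≢_; refl; sym; trans; cong; subst)
open import Relation.Nullary using (¬_; Dec; yes; no; contradiction)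
open import Relation.Nullary.Decidable using (_×-dec_; _⊎-dec_; map′)

-- Weakly decreasing sequences of naturals with finitely many nonzero terms.
-- `bound` is any bound on the number of nonzero parts, so one partition has
-- several representatives; every notion below depends on the diagram only.

record Partition : Set where
  field
    part       : ℕ → ℕ
    bound      : ℕ
    decreasing : ∀ a → part (suc a) ≤ part a
    vanishing  : ∀ a → bound ≤ a → part a ≡ 0

open Partition public

-- A position is (row , column), both counted from 0.  Compared with counting
-- from 1 this changes neither residues nor hook lengths, and it shifts the
-- index of every ladder by the same constant.

Position : Set
Position = ℕ × ℕ

infix 4 _∈_ _∉_ _∈?_

_∈_ _∉_ : Position → Partition → Set
(a , b) ∈ μ = b < part μ a
x ∉ μ = ¬ (x ∈ μ)

_∈?_ : ∀ x μ → Dec (x ∈ μ)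
(a , b) ∈? μ = b <? part μ a

boxes : Partition → List Position
boxes μ = concatMap (λ a → map (a ,_) (upTo (part μ a))) (upTo (bound μ))

InHook : Position → Position → Set
InHook (a , b) (c , d) = (c ≡ a × b ≤ d) ⊎ (d ≡ b × a ≤ c)

inHook? : ∀ x y → Dec (InHook x y)
inHook? (a , b) (c , d) =
  ((c ≟ a) ×-dec (b ≤? d)) ⊎-dec ((d ≟ b) ×-dec (a ≤? c))

hook : Partition → Position → ℕ
hook μ x = length (filter (inHook? x) (boxes μ))

JM : ℕ → Partition → Set
JM ℓ μ = ¬ (∃[ a ] ∃[ b ] ∃[ x ] ∃[ y ]
  (a , b) ∈ μ × (a , y) ∈ μ × (x , b) ∈ μ ×
  ℓ ∣ hook μ (a , b) × ¬ (ℓ ∣ hook μ (a , y)) × ¬ (ℓ ∣ hook μ (x , b)))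

Addable : Partition → Position → Set
Addable μ x = x ∉ μ × Σ Partition λ ν → ∀ y → y ∈ ν ⇔ (y ∈ μ ⊎ y ≡ x)

Removable : Partition → Position → Set
Removable μ x = x ∈ μ × Σ Partition λ ν → ∀ y → y ∈ ν ⇔ (y ∈ μ × y ≢ x)

Above : Partition → Position → Set
Above μ (zero  , b) = ⊤
Above μ (suc a , b) = b < part μ a

above? : ∀ μ x → Dec (Above μ x)
above? μ (zero  , b) = yes tt
above? μ (suc a , b) = b <? part μ a

OuterCorner : Partition → Position → Set
OuterCorner μ (a , b) = b ≡ part μ a × Above μ (a , b)

InnerCorner : Partition → Position → Set
InnerCorner μ (a , b) = suc b ≡ part μ a × part μ (suc a) ≤ b

private
  set : ℕ → ℕ → (ℕ → ℕ) → ℕ → ℕ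
  set a v f c with c ≟ a
  ... | yes _ = v
  ... | no  _ = f c

  set-at : ∀ a v f → set a v f a ≡ v
  set-at a v f with a ≟ a
  ... | yes _  = refl
  ... | no a≢a = ⊥-elim (a≢a refl)

  set-off : ∀ a v f {c} → c ≢ a → set a v f c ≡ f c
  set-off a v f {c} c≢a with c ≟ a
  ... | yes c≡a = ⊥-elim (c≢a c≡a)
  ... | no _    = refl

addable⇒corner : ∀ μ x → Addable μ x → OuterCorner μ x
addable⇒corner μ (a , b) (x∉μ , ν , ν-diag) = b≡ , above a refl
  where
  b<νa : b < part ν a
  b<νa = Equivalence.from (ν-diag (a , b)) (inj₂ refl)
  b≡ : b ≡ part μ a
  b≡ with part μ a ≟ b
  ... | yes e = sym e
  ... | no ne with Equivalence.to (ν-diag (a , part μ a))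
                     (≤-<-trans (≮⇒≥ x∉μ) b<νa)
  ...   | inj₁ p = ⊥-elim (<-irrefl refl p)
  ...   | inj₂ e = ⊥-elim (ne (cong proj₂ e))
  above : ∀ a′ → a′ ≡ a → Above μ (a′ , b)
  above zero    _    = tt
  above (suc c) refl with Equivalence.to (ν-diag (c , b))
                           (<-≤-trans b<νa (decreasing ν c))
  ... | inj₁ p = p
  ... | inj₂ e = ⊥-elim (<-irrefl (cong proj₁ e) ≤-refl)

corner⇒addable : ∀ μ x → OuterCorner μ x → Addable μ x
corner⇒addable μ (a , b) (refl , above) =
  <-irrefl refl , ν , λ { (c , d) → mk⇔ (to c d) (from c d) }
  where
  f : ℕ → ℕ
  f = set a (suc (part μ a)) (part μ)
  dec : ∀ c → f (suc c) ≤ f c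
  dec c with suc c ≟ a | c ≟ a
  ... | yes p    | yes q = ⊥-elim (<-irrefl (trans q (sym p)) ≤-refl)
  ... | yes refl | no _  = above
  ... | no _     | yes refl = m≤n⇒m≤1+n (decreasing μ c)
  ... | no _     | no _  = decreasing μ c
  van : ∀ c → suc a ⊔ bound μ ≤ c → f c ≡ 0
  van c p = trans
    (set-off a _ (part μ)
      λ { refl → <-irrefl refl (≤-trans (m≤m⊔n (suc a) (bound μ)) p) })
    (vanishing μ c (≤-trans (m≤n⊔m (suc a) (bound μ)) p))
  ν : Partition
  ν = record
    { part = f ; bound = suc a ⊔ bound μ ; decreasing = dec ; vanishing = van }
  to : ∀ c d → d < f c → (d < part μ c) ⊎ ((c , d) ≡ (a , part μ a))
  to c d p with c ≟ a
  ... | no _ = inj₁ p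
  ... | yes refl with m≤n⇒m<n∨m≡n (s≤s⁻¹ p)
  ...   | inj₁ q = inj₁ q
  ...   | inj₂ e = inj₂ (cong (c ,_) e)
  from : ∀ c d → (d < part μ c) ⊎ ((c , d) ≡ (a , part μ a)) → d < f c
  from c d p with c ≟ a
  from c d (inj₁ p)    | no _     = p
  from c d (inj₂ refl) | no c≢a   = ⊥-elim (c≢a refl)
  from c d (inj₁ p)    | yes refl = m≤n⇒m≤1+n p
  from c d (inj₂ refl) | yes refl = ≤-refl

removable⇒corner : ∀ μ x → Removable μ x → InnerCorner μ x
removable⇒corner μ (a , b) (x∈μ , ν , ν-diag) = row , below
  where
  νa≤b : part ν a ≤ b
  νa≤b = ≮⇒≥ λ p → proj₂ (Equivalence.to (ν-diag (a , b)) p) refl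
  row : suc b ≡ part μ a
  row with m≤n⇒m<n∨m≡n x∈μ
  ... | inj₂ e = e
  ... | inj₁ q = ⊥-elim (<-irrefl refl (≤-trans (≤-trans (n≤1+n _) p) νa≤b))
    where
    p : suc b < part ν a
    p = Equivalence.from (ν-diag (a , suc b))
          (q , λ e → <-irrefl (sym (cong proj₂ e)) ≤-refl)
  below : part μ (suc a) ≤ b
  below = ≮⇒≥ λ q → <-irrefl refl (≤-trans
    (Equivalence.from (ν-diag (suc a , b))
      (q , λ e → <-irrefl (sym (cong proj₁ e)) ≤-refl))
    (≤-trans (decreasing ν a) νa≤b))

corner⇒removable : ∀ μ x → InnerCorner μ x → Removable μ x
corner⇒removable μ (a , b) (row , below) =
  ≤-reflexive row , ν , λ { (c , d) → mk⇔ (to c d) (from c d) }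
  where
  f : ℕ → ℕ
  f = set a b (part μ)
  dec : ∀ c → f (suc c) ≤ f c
  dec c with suc c ≟ a | c ≟ a
  ... | yes p    | yes q    = ⊥-elim (<-irrefl (trans q (sym p)) ≤-refl)
  ... | yes refl | no _     =
    ≤-trans (n≤1+n b) (≤-trans (≤-reflexive row) (decreasing μ c))
  ... | no _     | yes refl = below
  ... | no _     | no _     = decreasing μ c
  van : ∀ c → bound μ ≤ c → f c ≡ 0
  van c p with c ≟ a
  ... | yes refl = contradiction (trans row (vanishing μ c p)) λ ()
  ... | no _     = vanishing μ c p
  ν : Partition
  ν = record { part = f ; bound = bound μ ; decreasing = dec ; vanishing = van }
  to : ∀ c d → d < f c → (d < part μ c) × ((c , d) ≢ (a , b))
  to c d p with c ≟ a
  ... | no c≢a   = p , λ e → c≢a (cong proj₁ e)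
  ... | yes refl = ≤-trans (m≤n⇒m≤1+n p) (≤-reflexive row)
                 , λ e → <-irrefl (cong proj₂ e) p
  from : ∀ c d → (d < part μ c) × ((c , d) ≢ (a , b)) → d < f c
  from c d (p , x≢) with c ≟ a
  ... | no _     = p
  ... | yes refl with m≤n⇒m<n∨m≡n (s≤s⁻¹ (≤-trans p (≤-reflexive (sym row))))
  ...   | inj₁ q = q
  ...   | inj₂ e = ⊥-elim (x≢ (cong (c ,_) e))

addable? : ∀ μ x → Dec (Addable μ x)
addable? μ x@(a , b) = map′ (corner⇒addable μ x) (addable⇒corner μ x)
  ((b ≟ part μ a) ×-dec above? μ x)

removable? : ∀ μ x → Dec (Removable μ x)
removable? μ x@(a , b) = map′ (corner⇒removable μ x) (removable⇒corner μ x)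
  ((suc b ≟ part μ a) ×-dec (part μ (suc a) ≤? b))

residue : (ℓ : ℕ) .{{_ : NonZero ℓ}} → Position → ℕ
residue ℓ (a , b) = (ℤ.+ b ℤ.- ℤ.+ a) ℤ.%ℕ ℓ

-- (a , b) and (c , d) lie on the same ladder, c - a = (ℓ - 1)(b - d), exactly
-- when their ladder indices agree; ladders are ordered by their index.

ladderIndex : ℕ → Position → ℕ
ladderIndex ℓ (a , b) = a + (ℓ ∸ 1) * b

-- A rectangle of positions, row by row, that contains every addable and every
-- removable box (see `addable-read` and `removable-read`).

window : Partition → List Position
window μ = cartesianProduct (upTo (suc (bound μ))) (upTo (suc (part μ 0)))

-- The window read ladder by ladder from left to right, and from top to bottom
-- on each ladder.

readingOrder : ℕ → Partition → List Position
readingOrder ℓ μ =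
  concatMap (λ L → filter (λ x → ladderIndex ℓ x ≟ L) (window μ))
            (upTo (suc (ladderIndex ℓ (bound μ , part μ 0))))

data Letter (μ : Partition) : Set where
  plus  : ∀ x → Addable μ x → Letter μ
  minus : ∀ x → Removable μ x → Letter μ

letter : (ℓ : ℕ) .{{_ : NonZero ℓ}} → ℕ → (μ : Partition) →
         Position → Maybe (Letter μ)
letter ℓ i μ x with residue ℓ x ≟ i | addable? μ x | removable? μ x
... | no _  | _     | _     = nothing
... | yes _ | yes p | _     = just (plus x p)
... | yes _ | no _  | yes p = just (minus x p)
... | yes _ | no _  | no _  = nothing

signature : (ℓ : ℕ) .{{_ : NonZero ℓ}} → ℕ → (μ : Partition) → List (Letter μ)
signature ℓ i μ = mapMaybe (letter ℓ i μ) (readingOrder ℓ μ)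

cancel : ∀ {μ} → Letter μ → List (Letter μ) → List (Letter μ)
cancel (minus _ _) (plus _ _ ∷ w) = w
cancel s           w              = s ∷ w

-- Cancellation of adjacent pairs -+ until none is left; see `reduce-reaches`
-- and `reduce-irreducible`.

reduce : ∀ {μ} → List (Letter μ) → List (Letter μ)
reduce = foldr cancel []

reducedSignature : (ℓ : ℕ) .{{_ : NonZero ℓ}} → ℕ →
                   (μ : Partition) → List (Letter μ)
reducedSignature ℓ i μ = reduce (signature ℓ i μ)

pluses : ∀ {μ} → List (Letter μ) → List (∃ (Addable μ))
pluses []              = []
pluses (plus x p  ∷ w) = (x , p) ∷ pluses w
pluses (minus _ _ ∷ w) = pluses w

minuses : ∀ {μ} → List (Letter μ) → List (∃ (Removable μ))
minuses []              = []
minuses (plus _ _  ∷ w) = minuses w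
minuses (minus x p ∷ w) = (x , p) ∷ minuses w

φ̂ : (ℓ : ℕ) .{{_ : NonZero ℓ}} → ℕ → Partition → ℕ
φ̂ ℓ i μ = length (pluses (reducedSignature ℓ i μ))

ε̂ : (ℓ : ℕ) .{{_ : NonZero ℓ}} → ℕ → Partition → ℕ
ε̂ ℓ i μ = length (minuses (reducedSignature ℓ i μ))

-- `nothing` plays the role of 0.  The new partition is the one carried by the
-- proof of addability or removability; its diagram is that of μ with the box
-- added or removed.

f̂ : (ℓ : ℕ) .{{_ : NonZero ℓ}} → ℕ → Partition → Maybe Partition
f̂ ℓ i μ = Maybe.map (λ (_ , _ , ν , _) → ν) (last (pluses (reducedSignature ℓ i μ)))

ê : (ℓ : ℕ) .{{_ : NonZero ℓ}} → ℕ → Partition → Maybe Partition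
ê ℓ i μ = Maybe.map (λ (_ , _ , ν , _) → ν) (head (minuses (reducedSignature ℓ i μ)))

power : (Partition → Maybe Partition) → ℕ → Partition → Maybe Partition
power g k μ = fold (just μ) (_>>= g) k

infix 4 _⟶_

data _⟶_ {μ} : List (Letter μ) → List (Letter μ) → Set where
  here  : ∀ {x p y q w} → minus x p ∷ plus y q ∷ w ⟶ w
  there : ∀ {s w w′} → w ⟶ w′ → s ∷ w ⟶ s ∷ w′

private
  cancel-reaches : ∀ {μ} (s : Letter μ) w → Star _⟶_ (s ∷ w) (cancel s w)
  cancel-reaches (plus _ _)  w                = ε
  cancel-reaches (minus _ _) []               = ε
  cancel-reaches (minus _ _) (plus _ _ ∷ w)   = here ◅ ε
  cancel-reaches (minus _ _) (minus _ _ ∷ w)  = ε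

  cancel-irreducible : ∀ {μ} (s : Letter μ) w → (∀ {w′} → ¬ (w ⟶ w′)) →
                       ∀ {w′} → ¬ (cancel s w ⟶ w′)
  cancel-irreducible (plus _ _)  w               irr (there r) = irr r
  cancel-irreducible (minus _ _) []              irr (there r) = irr r
  cancel-irreducible (minus _ _) (plus _ _ ∷ w)  irr r         = irr (there r)
  cancel-irreducible (minus _ _) (minus _ _ ∷ w) irr (there r) = irr r

reduce-reaches : ∀ {μ} (w : List (Letter μ)) → Star _⟶_ w (reduce w)
reduce-reaches []      = ε
reduce-reaches (s ∷ w) =
  gmap (s ∷_) there (reduce-reaches w) ◅◅ cancel-reaches s (reduce w)

reduce-irreducible : ∀ {μ} (w : List (Letter μ)) {w′} → ¬ (reduce w ⟶ w′)
reduce-irreducible []      ()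
reduce-irreducible (s ∷ w) =
  cancel-irreducible s (reduce w) (reduce-irreducible w)

private
  part≤part0 : ∀ μ a → part μ a ≤ part μ 0
  part≤part0 μ zero    = ≤-refl
  part≤part0 μ (suc a) = ≤-trans (decreasing μ a) (part≤part0 μ a)

  row-bound : ∀ μ {a b} → b < part μ a → a < bound μ
  row-bound μ {a} p = ≰⇒> λ q →
    contradiction (subst (_ <_) (vanishing μ a q) p) λ ()

  read : ∀ ℓ μ {a b} → a ≤ bound μ → b ≤ part μ 0 →
         (a , b) ∈ˡ readingOrder ℓ μ
  read ℓ μ {a} {b} p q = ∈-concatMap⁺ _ (AnyL.map
    (λ { refl → ∈-filter⁺ (λ x → ladderIndex ℓ x ≟ ladderIndex ℓ (a , b))
                  (∈-cartesianProduct⁺ (∈-upTo⁺ (s≤s p)) (∈-upTo⁺ (s≤s q)))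
                  refl })
    (∈-upTo⁺ (s≤s (+-mono-≤ p (*-monoʳ-≤ (ℓ ∸ 1) q)))))

addable-read : ∀ ℓ μ x → Addable μ x → x ∈ˡ readingOrder ℓ μ
addable-read ℓ μ (a , b) p with addable⇒corner μ (a , b) p
... | b≡ , above = read ℓ μ (rows a above)
                     (≤-trans (≤-reflexive b≡) (part≤part0 μ a))
  where
  rows : ∀ a′ → Above μ (a′ , b) → a′ ≤ bound μ
  rows zero    _ = z≤n
  rows (suc c) q = row-bound μ q

removable-read : ∀ ℓ μ x → Removable μ x → x ∈ˡ readingOrder ℓ μ
removable-read ℓ μ (a , b) (x∈μ , _) =
  read ℓ μ (<⇒≤ (row-bound μ x∈μ)) (≤-trans (<⇒≤ x∈μ) (part≤part0 μ a))

{-# OPTIONS --safe #-}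
module Submission where

-- In a JM partition an addable and a removable box of residue i, together with
-- a further addable box of residue i, cannot coexist.  Let p = (a , b) and
-- q = (a′ , b′) be addable with a < a′ and let r = (c , d) be removable.  The
-- hook at (a , b′) has length ≡ -1 (mod ℓ) and the hook at r has length 1.
-- If r lies below p, the hook at (a , d) has length divisible by ℓ, so (a , d),
-- (a , b′), r violate the JM condition; otherwise (c , b′), r, (a , b′) do.
--
-- For 0 < k < φ̂ - 1 the last box added by f̂ᵏ is removable, and at least
-- φ̂ - k ≥ 2 of the addable boxes of the reduced signature survive.  For
-- 1 < k < ε̂ the k ≥ 2 boxes removed by êᵏ are addable, and at least ε̂ - k ≥ 1
-- of the removable boxes of the reduced signature survive.

open import Defs
open import Data.Nat.Base using (ℕ; NonZero; _<_; _≥_; _∸_)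
open import Data.Maybe.Relation.Unary.Any using (Any)
open import Data.Product.Base using (_×_)
open import Relation.Nullary using (¬_)

open import Data.Empty using (⊥; ⊥-elim)
import Data.Integer.Base as ℤ
open import Data.Integer.DivMod using (a≡a%ℕn+[a/ℕn]*n)
import Data.Integer.Divisibility.Signed as ℤ∣
import Data.Integer.Properties as ℤ
open import Data.Integer.Tactic.RingSolver using (solve-∀)
open import Data.List.Base
  using (List; []; _∷_; _++_; length; map; filter; concatMap; mapMaybe; upTo)
open import Data.List.Properties
  using (upTo-∷ʳ; concatMap-++; map-++; filter-++; length-++; ++-identityʳ;
         filter-none; filter-accept; filter-reject)
open import Data.List.Membership.Propositional.Properties using (∈-filter⁻)
open import Data.List.Relation.Binary.Sublist.Propositional
  using (_⊆_; []; _∷_; _∷ʳ_; ⊆-refl; ⊆-trans)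
open import Data.List.Relation.Binary.Sublist.Propositional.Properties
  using (All-resp-⊆; map⁺)
open import Data.List.Relation.Unary.All as All using (All; []; _∷_)
import Data.List.Relation.Unary.All.Properties as All
open import Data.List.Relation.Unary.AllPairs as AllPairs using (AllPairs; []; _∷_)
import Data.List.Relation.Unary.AllPairs.Properties as AllPairs
open import Data.List.Relation.Unary.Unique.Propositional using (Unique)
open import Data.List.Relation.Unary.Unique.Propositional.Properties
  using (concat⁺; cartesianProduct⁺; filter⁺; upTo⁺)
open import Data.Maybe.Base using (Maybe; just; nothing)
import Data.Maybe.Relation.Unary.All as MaybeAll
import Data.Maybe.Relation.Unary.All.Properties as MaybeAll
import Data.Maybe.Relation.Unary.Any as MaybeAny
open import Data.Nat.Base
  using (zero; suc; pred; _+_; _≤_; _⊔_; _⊓_; z≤n; s≤s; s≤s⁻¹)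
open import Data.Nat.Divisibility using (_∣_; ∣1⇒≡1; ∣m+n∣m⇒∣n)
open import Data.Nat.Properties
open import Data.Product.Base using (∃; ∃-syntax; _,_; proj₁; proj₂)
open import Data.Product.Properties using (≡-dec)
open import Data.Sum.Base as Sum using (_⊎_; inj₁; inj₂; [_,_])
open import Data.Unit.Base using (tt)
open import Function.Base using (_∘_; id)
open import Function.Bundles using (_⇔_; mk⇔; Equivalence)
open import Relation.Binary.Definitions using (DecidableEquality; tri<; tri≈; tri>)
open import Relation.Binary.PropositionalEquality
  using (_≡_; _≢_; refl; sym; trans; cong; cong₂; subst; module ≡-Reasoning)
open import Relation.Nullary using (yes; no; contradiction)
open import Relation.Unary using (Decidable)

-- Hook lengths

-- `hook` filters a list of rows from top to bottom. Splitting off the last row, not the first,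
-- allows induction on the number of rows read.
length-filter-concatMap-upTo :
  ∀ {A : Set} {P : A → Set} (P? : Decidable P) (f : ℕ → List A) n →
  length (filter P? (concatMap f (upTo (suc n)))) ≡
  length (filter P? (concatMap f (upTo n))) + length (filter P? (f n))
length-filter-concatMap-upTo P? f n = begin
  length (filter P? (concatMap f (upTo (suc n))))
    ≡⟨ cong (length ∘ filter P? ∘ concatMap f) (upTo-∷ʳ n) ⟨
  length (filter P? (concatMap f (upTo n ++ n ∷ [])))
    ≡⟨ cong (length ∘ filter P?) (concatMap-++ f (upTo n) (n ∷ [])) ⟩
  length (filter P? (concatMap f (upTo n) ++ (f n ++ [])))
    ≡⟨ cong (λ ys → length (filter P? (concatMap f (upTo n) ++ ys)))
         (++-identityʳ (f n)) ⟩
  length (filter P? (concatMap f (upTo n) ++ f n))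
    ≡⟨ cong length (filter-++ P? (concatMap f (upTo n)) (f n)) ⟩
  length (filter P? (concatMap f (upTo n)) ++ filter P? (f n))
    ≡⟨ length-++ (filter P? (concatMap f (upTo n))) ⟩
  length (filter P? (concatMap f (upTo n))) + length (filter P? (f n)) ∎
  where open ≡-Reasoning

length-filter-map-upTo :
  ∀ {A : Set} {P : A → Set} (P? : Decidable P) (f : ℕ → A) n →
  length (filter P? (map f (upTo (suc n)))) ≡
  length (filter P? (map f (upTo n))) + length (filter P? (f n ∷ []))
length-filter-map-upTo P? f n = begin
  length (filter P? (map f (upTo (suc n))))
    ≡⟨ cong (length ∘ filter P? ∘ map f) (upTo-∷ʳ n) ⟨
  length (filter P? (map f (upTo n ++ n ∷ [])))
    ≡⟨ cong (length ∘ filter P?) (map-++ f (upTo n) (n ∷ [])) ⟩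
  length (filter P? (map f (upTo n) ++ f n ∷ []))
    ≡⟨ cong length (filter-++ P? (map f (upTo n)) (f n ∷ [])) ⟩
  length (filter P? (map f (upTo n)) ++ filter P? (f n ∷ []))
    ≡⟨ length-++ (filter P? (map f (upTo n))) ⟩
  length (filter P? (map f (upTo n))) + length (filter P? (f n ∷ [])) ∎
  where open ≡-Reasoning

part-antitone : ∀ μ {a c} → a ≤ c → part μ c ≤ part μ a
part-antitone μ {a} {c} a≤c =
  subst (λ e → part μ e ≤ part μ a) (m∸n+n≡m a≤c) (go (c ∸ a))
  where
  go : ∀ k → part μ (k + a) ≤ part μ a
  go zero    = ≤-refl
  go (suc k) = ≤-trans (decreasing μ (k + a)) (go k)

-- The row length n is a free parameter, so that the share of a row in the hook can be found by
-- induction on n.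
hookInRow : Position → ℕ → ℕ → ℕ
hookInRow x c n = length (filter (inHook? x) (map (c ,_) (upTo n)))

hookInRow-empty : ∀ x c n → (∀ {d} → d < n → ¬ InHook x (c , d)) →
                  hookInRow x c n ≡ 0
hookInRow-empty x c n out = cong length
  (filter-none (inHook? x) (All.map⁺ (All.map out (All.all-upTo n))))

hookInRow-arm : ∀ a b n → hookInRow (a , b) a n ≡ n ∸ b
hookInRow-arm a b zero    = sym (0∸n≡0 b)
hookInRow-arm a b (suc n) with b ≤? n
... | yes b≤n = begin
  hookInRow (a , b) a (suc n)
    ≡⟨ length-filter-map-upTo (inHook? (a , b)) (a ,_) n ⟩
  hookInRow (a , b) a n + length (filter (inHook? (a , b)) ((a , n) ∷ []))
    ≡⟨ cong₂ _+_ (hookInRow-arm a b n)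
         (cong length (filter-accept (inHook? (a , b)) (inj₁ (refl , b≤n)))) ⟩
  n ∸ b + 1
    ≡⟨ +-comm (n ∸ b) 1 ⟩
  suc (n ∸ b)
    ≡⟨ +-∸-assoc 1 b≤n ⟨
  suc n ∸ b ∎
  where open ≡-Reasoning
-- The row stops before column b: no box counts, and the truncated difference is 0 as well.
... | no b≰n = trans
  (hookInRow-empty (a , b) a (suc n) λ where
    d<1+n (inj₁ (_ , b≤d))  → b≰n (≤-trans b≤d (s≤s⁻¹ d<1+n))
    d<1+n (inj₂ (refl , _)) → b≰n (s≤s⁻¹ d<1+n))
  (sym (m≤n⇒m∸n≡0 (≰⇒> b≰n)))

hookInRow-leg : ∀ a b c n → a < c → b < n → hookInRow (a , b) c n ≡ 1
hookInRow-leg a b c (suc n) a<c b<1+n with m≤n⇒m<n∨m≡n (s≤s⁻¹ b<1+n)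
... | inj₁ b<n = trans (length-filter-map-upTo (inHook? (a , b)) (c ,_) n)
  (cong₂ _+_ (hookInRow-leg a b c n a<c b<n)
    (cong length (filter-reject (inHook? (a , b)) {x = c , n} {xs = []} λ where
      (inj₁ (refl , _)) → <-irrefl refl a<c
      (inj₂ (refl , _)) → <-irrefl refl b<n)))
-- The last box read is the one in column b. All earlier ones lie to its left, outside the hook.
... | inj₂ refl = trans (length-filter-map-upTo (inHook? (a , b)) (c ,_) n)
  (cong₂ _+_
    (hookInRow-empty (a , b) c n λ where
      _   (inj₁ (refl , _)) → <-irrefl refl a<c
      d<b (inj₂ (refl , _)) → <-irrefl refl d<b)
    (cong length (filter-accept (inHook? (a , b)) (inj₂ (refl , <⇒≤ a<c)))))

-- e is the last row that meets column b.
hook-arm-leg : ∀ μ {a b e} → a ≤ e → b < part μ e → part μ (suc e) ≤ b →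
               hook μ (a , b) ≡ (part μ a ∸ b) + (e ∸ a)
hook-arm-leg μ {a} {b} {e} a≤e b<e e<b = begin
  -- Rows above a and below e contribute nothing. Row a contributes the arm together with the corner
  -- box, and each of the e - a rows below it one box.
  upToRow (bound μ)                     ≡⟨ cong upToRow (m+[n∸m]≡n e<bound) ⟨
  upToRow (suc e + (bound μ ∸ suc e))   ≡⟨ below (bound μ ∸ suc e) ⟩
  upToRow (suc e)                       ≡⟨ cong (upToRow ∘ suc) (m+[n∸m]≡n a≤e) ⟨
  upToRow (suc (a + (e ∸ a)))
    ≡⟨ within (e ∸ a) (≤-reflexive (m+[n∸m]≡n a≤e)) ⟩
  (part μ a ∸ b) + (e ∸ a)              ∎
  where
  open ≡-Reasoning
  row : ℕ → List Position
  row c = map (c ,_) (upTo (part μ c))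
  upToRow : ℕ → ℕ
  upToRow n = length (filter (inHook? (a , b)) (concatMap row (upTo n)))
  step : ∀ n → upToRow (suc n) ≡ upToRow n + hookInRow (a , b) n (part μ n)
  step = length-filter-concatMap-upTo (inHook? (a , b)) row
  e<bound : e < bound μ
  e<bound = ≰⇒> λ bound≤e →
    contradiction (subst (b <_) (vanishing μ e bound≤e) b<e) λ ()
  above : ∀ n → n ≤ a → upToRow n ≡ 0
  above zero    _   = refl
  above (suc n) n<a = trans (step n) (cong₂ _+_ (above n (<⇒≤ n<a))
    (hookInRow-empty (a , b) n (part μ n) λ where
      _ (inj₁ (refl , _)) → <-irrefl refl n<a
      _ (inj₂ (_ , a≤n))  → <-irrefl refl (<-≤-trans n<a a≤n)))
  within : ∀ k → a + k ≤ e → upToRow (suc (a + k)) ≡ (part μ a ∸ b) + k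
  within zero    _ rewrite +-identityʳ a | +-identityʳ (part μ a ∸ b) =
    trans (step a) (cong₂ _+_ (above a ≤-refl) (hookInRow-arm a b (part μ a)))
  within (suc k) a+1+k≤e rewrite +-suc a k = begin
    upToRow (suc (suc (a + k)))
      ≡⟨ step (suc (a + k)) ⟩
    upToRow (suc (a + k)) + hookInRow (a , b) (suc (a + k)) (part μ (suc (a + k)))
      ≡⟨ cong₂ _+_ (within k (<⇒≤ a+1+k≤e))
           (hookInRow-leg a b _ _ (s≤s (m≤m+n a k))
             (<-≤-trans b<e (part-antitone μ a+1+k≤e))) ⟩
    (part μ a ∸ b) + k + 1
      ≡⟨ +-assoc (part μ a ∸ b) k 1 ⟩
    (part μ a ∸ b) + (k + 1)
      ≡⟨ cong (part μ a ∸ b +_) (+-comm k 1) ⟩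
    (part μ a ∸ b) + suc k ∎
  below : ∀ k → upToRow (suc e + k) ≡ upToRow (suc e)
  below zero    = cong upToRow (+-identityʳ (suc e))
  below (suc k) = begin
    upToRow (suc e + suc k)    ≡⟨ cong upToRow (+-suc (suc e) k) ⟩
    upToRow (suc (suc e + k))  ≡⟨ step (suc e + k) ⟩
    upToRow (suc e + k) + hookInRow (a , b) (suc e + k) (part μ (suc e + k))
      ≡⟨ cong₂ _+_ (below k)
           (hookInRow-empty (a , b) (suc e + k) _ λ where
             _ (inj₁ (refl , _)) →
               <-irrefl refl (≤-trans (s≤s (m≤m+n e k)) a≤e)
             d<  (inj₂ (refl , _)) →
               <-irrefl refl (<-≤-trans d<
                 (≤-trans (part-antitone μ (m≤m+n (suc e) k)) e<b))) ⟩
    upToRow (suc e) + 0        ≡⟨ +-identityʳ _ ⟩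
    upToRow (suc e)            ∎

-- Residues

-- Equal residues make (b - a) - (d - c) a multiple of ℓ. Regrouped as (b - d) + (c - a), a sum of
-- two natural numbers, it has the arm-plus-leg shape of `hook-arm-leg`.
residue≡⇒∣ : ∀ ℓ .{{_ : NonZero ℓ}} {a b c d} → a ≤ c → d ≤ b →
             residue ℓ (a , b) ≡ residue ℓ (c , d) → ℓ ∣ (b ∸ d) + (c ∸ a)
residue≡⇒∣ ℓ {a} {b} {c} {d} a≤c d≤b res≡ =
  ℤ∣.∣⇒∣ᵤ (ℤ∣.divides (u ℤ./ℕ ℓ ℤ.- v ℤ./ℕ ℓ) diff)
  where
  u = ℤ.+ b ℤ.- ℤ.+ a
  v = ℤ.+ d ℤ.- ℤ.+ c
  regroup₁ : ∀ b d c a →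
             (b ℤ.- d) ℤ.+ (c ℤ.- a) ≡ (b ℤ.- a) ℤ.- (d ℤ.- c)
  regroup₁ = solve-∀
  regroup₂ : ∀ r s t l →
             (r ℤ.+ s ℤ.* l) ℤ.- (r ℤ.+ t ℤ.* l) ≡ (s ℤ.- t) ℤ.* l
  regroup₂ = solve-∀
  monus : ∀ {m n} → n ≤ m → ℤ.+ (m ∸ n) ≡ ℤ.+ m ℤ.- ℤ.+ n
  monus {m} {n} n≤m = sym (trans (ℤ.m-n≡m⊖n m n) (ℤ.⊖-≥ n≤m))
  open ≡-Reasoning
  diff : ℤ.+ ((b ∸ d) + (c ∸ a)) ≡ (u ℤ./ℕ ℓ ℤ.- v ℤ./ℕ ℓ) ℤ.* ℤ.+ ℓ
  diff = begin
    ℤ.+ (b ∸ d) ℤ.+ ℤ.+ (c ∸ a)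
      ≡⟨ cong₂ ℤ._+_ (monus d≤b) (monus a≤c) ⟩
    (ℤ.+ b ℤ.- ℤ.+ d) ℤ.+ (ℤ.+ c ℤ.- ℤ.+ a)
      ≡⟨ regroup₁ (ℤ.+ b) (ℤ.+ d) (ℤ.+ c) (ℤ.+ a) ⟩
    u ℤ.- v
      ≡⟨ cong₂ ℤ._-_ (a≡a%ℕn+[a/ℕn]*n u ℓ)
           (trans (a≡a%ℕn+[a/ℕn]*n v ℓ)
             (cong (λ r → ℤ.+ r ℤ.+ v ℤ./ℕ ℓ ℤ.* ℤ.+ ℓ) (sym res≡))) ⟩
    (ℤ.+ (u ℤ.%ℕ ℓ) ℤ.+ u ℤ./ℕ ℓ ℤ.* ℤ.+ ℓ)
      ℤ.- (ℤ.+ (u ℤ.%ℕ ℓ) ℤ.+ v ℤ./ℕ ℓ ℤ.* ℤ.+ ℓ)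
      ≡⟨ regroup₂ (ℤ.+ (u ℤ.%ℕ ℓ)) (u ℤ./ℕ ℓ) (v ℤ./ℕ ℓ) (ℤ.+ ℓ) ⟩
    (u ℤ./ℕ ℓ ℤ.- v ℤ./ℕ ℓ) ℤ.* ℤ.+ ℓ ∎

module _ (ℓ : ℕ) .{{_ : NonZero ℓ}} (ℓ≥2 : 2 ≤ ℓ) where

  -- The number 1 occurs both as the hook length of a removable box and as the difference of
  -- contents of two neighbouring positions.
  ℓ∤1 : ¬ (ℓ ∣ 1)
  ℓ∤1 ℓ∣1 = <-irrefl (sym (∣1⇒≡1 ℓ∣1)) ℓ≥2

  residue-right : ∀ a b → residue ℓ (a , suc b) ≢ residue ℓ (a , b)
  residue-right a b res≡ = ℓ∤1
    (subst (ℓ ∣_) (cong₂ _+_ (m+n∸n≡m 1 b) (n∸n≡0 a))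
      (residue≡⇒∣ ℓ {a} ≤-refl (n≤1+n b) res≡))

  residue-below : ∀ a b → residue ℓ (a , b) ≢ residue ℓ (suc a , b)
  residue-below a b res≡ = ℓ∤1
    (subst (ℓ ∣_) (cong₂ _+_ (n∸n≡0 b) (m+n∸n≡m 1 a))
      (residue≡⇒∣ ℓ {b = b} (n≤1+n a) ≤-refl res≡))

-- Addable and removable boxes in a JM partition

module _ (ℓ : ℕ) .{{_ : NonZero ℓ}} (i : ℕ) where

  AddableI RemovableI : Partition → Position → Set
  AddableI   μ x = Addable μ x × residue ℓ x ≡ i
  RemovableI μ x = Removable μ x × residue ℓ x ≡ i

module _ (ℓ : ℕ) .{{_ : NonZero ℓ}} (ℓ≥2 : 2 ≤ ℓ) (i : ℕ) where

  JM-row-order : ∀ μ {a b a′ b′ c d} → AddableI ℓ i μ (a , b) →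
                 AddableI ℓ i μ (a′ , b′) → a < a′ → RemovableI ℓ i μ (c , d) →
                 ¬ JM ℓ μ
  -- Since a < a′, the row of q can be written suc e. As q is addable, e is then the last row that
  -- meets column b′.
  JM-row-order μ {a} {b} {suc e} {b′} {c} {d}
               (add-p , res-p) (add-q , res-q) (s≤s a≤e) (rem-r , res-r) jm
    with addable⇒corner μ _ add-p | addable⇒corner μ _ add-q
       | removable⇒corner μ _ rem-r
  ... | refl , _ | refl , b′<e | row-r , below-r = violation
    where
    b′<b : b′ < b
    b′<b = <-≤-trans b′<e (part-antitone μ a≤e)
    r∈μ : d < part μ c
    r∈μ = ≤-reflexive row-r
    hook-r : ¬ (ℓ ∣ hook μ (c , d))
    hook-r ℓ∣h = ℓ∤1 ℓ ℓ≥2 (subst (ℓ ∣_) (begin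
      hook μ (c , d)             ≡⟨ hook-arm-leg μ ≤-refl r∈μ below-r ⟩
      (part μ c ∸ d) + (c ∸ c)   ≡⟨ cong₂ _+_ (cong (_∸ d) (sym row-r)) (n∸n≡0 c) ⟩
      (suc d ∸ d) + 0            ≡⟨ cong (_+ 0) (m+n∸n≡m 1 d) ⟩
      1                          ∎) ℓ∣h)
      where open ≡-Reasoning
    -- The congruence between p and q counts rows down to suc e, while the leg of (a , b′) ends in
    -- row e. So the hook length plus 1 is divisible by ℓ.
    hook-pq : ¬ (ℓ ∣ hook μ (a , b′))
    hook-pq ℓ∣h = ℓ∤1 ℓ ℓ≥2 (∣m+n∣m⇒∣n
      (subst (ℓ ∣_) (begin
        (b ∸ b′) + (suc e ∸ a)    ≡⟨ cong (b ∸ b′ +_) (+-∸-assoc 1 a≤e) ⟩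
        (b ∸ b′) + (1 + (e ∸ a))  ≡⟨ cong (b ∸ b′ +_) (+-comm 1 (e ∸ a)) ⟩
        (b ∸ b′) + ((e ∸ a) + 1)  ≡⟨ +-assoc (b ∸ b′) (e ∸ a) 1 ⟨
        (b ∸ b′) + (e ∸ a) + 1    ≡⟨ cong (_+ 1) (hook-arm-leg μ a≤e b′<e ≤-refl) ⟨
        hook μ (a , b′) + 1       ∎)
        (residue≡⇒∣ ℓ (m≤n⇒m≤1+n a≤e) (<⇒≤ b′<b) (trans res-p (sym res-q))))
      ℓ∣h)
      where open ≡-Reasoning
    violation : ⊥
    violation with a ≤? c
    ... | yes a≤c = jm (a , d , c , b′ , d<b , b′<b , r∈μ , ℓ∣h , hook-pq , hook-r)
      where
      d<b : d < b
      d<b = <-≤-trans r∈μ (part-antitone μ a≤c)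
      -- This hook ends just left of p and, because r is a corner, in row c. Its length is therefore
      -- exactly the content difference of p and r.
      ℓ∣h : ℓ ∣ hook μ (a , d)
      ℓ∣h = subst (ℓ ∣_) (sym (hook-arm-leg μ a≤c r∈μ below-r))
        (residue≡⇒∣ ℓ a≤c (<⇒≤ d<b) (trans res-p (sym res-r)))
    ... | no a≰c =
      jm (c , b′ , a , d , <-≤-trans b′<b b≤ , r∈μ , b′<b , ℓ∣h , hook-r , hook-pq)
      where
      c≤a = <⇒≤ (≰⇒> a≰c)
      b≤ : b ≤ part μ c
      b≤ = part-antitone μ c≤a
      c≤e = ≤-trans c≤a a≤e
      b′≤d : b′ ≤ d
      b′≤d = s≤s⁻¹ (subst (b′ <_) (sym row-r) (<-≤-trans b′<b b≤))
      open ≡-Reasoning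
      -- Row c contributes d - b′ + 1 boxes and the leg stops one row above q. The two shifts
      -- cancel, which leaves the content difference of r and q.
      ℓ∣h : ℓ ∣ hook μ (c , b′)
      ℓ∣h = subst (ℓ ∣_) (begin
        (d ∸ b′) + (suc e ∸ c)    ≡⟨ cong (d ∸ b′ +_) (+-∸-assoc 1 c≤e) ⟩
        (d ∸ b′) + suc (e ∸ c)    ≡⟨ +-suc (d ∸ b′) (e ∸ c) ⟩
        suc (d ∸ b′) + (e ∸ c)    ≡⟨ cong (_+ (e ∸ c)) (+-∸-assoc 1 b′≤d) ⟨
        (suc d ∸ b′) + (e ∸ c)    ≡⟨ cong (λ n → (n ∸ b′) + (e ∸ c)) row-r ⟩
        (part μ c ∸ b′) + (e ∸ c) ≡⟨ hook-arm-leg μ c≤e b′<e ≤-refl ⟨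
        hook μ (c , b′)           ∎)
        (residue≡⇒∣ ℓ (m≤n⇒m≤1+n c≤e) b′≤d (trans res-r (sym res-q)))

  -- A row has at most one addable position, so two distinct ones lie in different rows and can be
  -- ordered by row.
  two-addable-one-removable⇒¬JM :
    ∀ μ {p q r} → AddableI ℓ i μ p → AddableI ℓ i μ q → q ≢ p →
    RemovableI ℓ i μ r → ¬ JM ℓ μ
  two-addable-one-removable⇒¬JM μ {a , b} {a′ , b′} p q q≢p r
    with <-cmp a a′
  ... | tri< a<a′ _ _ = JM-row-order μ p q a<a′ r
  ... | tri> _ _ a′<a = JM-row-order μ q p a′<a r
  ... | tri≈ _ refl _ = contradiction
    (cong (a ,_) (trans (proj₁ (addable⇒corner μ _ (proj₁ q)))
                        (sym (proj₁ (addable⇒corner μ _ (proj₁ p))))))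
    q≢p

-- Diagrams that differ by one box

-- These supply the partitions that `Addable` and `Removable` carry as witnesses when a box is moved
-- past another one.
union intersection : Partition → Partition → Partition
union μ ν = record
  { part       = λ a → part μ a ⊔ part ν a
  ; bound      = bound μ ⊔ bound ν
  ; decreasing = λ a → ⊔-mono-≤ (decreasing μ a) (decreasing ν a)
  ; vanishing  = λ a p → cong₂ _⊔_
      (vanishing μ a (m⊔n≤o⇒m≤o (bound μ) (bound ν) p))
      (vanishing ν a (m⊔n≤o⇒n≤o (bound μ) (bound ν) p))
  }
intersection μ ν = record
  { part       = λ a → part μ a ⊓ part ν a
  ; bound      = bound μ
  ; decreasing = λ a → ⊓-mono-≤ (decreasing μ a) (decreasing ν a)
  ; vanishing  = λ a p → cong (_⊓ part ν a) (vanishing μ a p)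
  }

∈-union : ∀ μ ν x → x ∈ union μ ν ⇔ (x ∈ μ ⊎ x ∈ ν)
∈-union μ ν (a , b) = mk⇔ to
  [ m<n⇒m<n⊔o (part ν a) , m<n⇒m<o⊔n (part μ a) ]
  where
  to : b < part μ a ⊔ part ν a → b < part μ a ⊎ b < part ν a
  to p with ⊔-sel (part μ a) (part ν a)
  ... | inj₁ e = inj₁ (subst (b <_) e p)
  ... | inj₂ e = inj₂ (subst (b <_) e p)

∈-intersection : ∀ μ ν x → x ∈ intersection μ ν ⇔ (x ∈ μ × x ∈ ν)
∈-intersection μ ν (a , b) = mk⇔
  (λ p → m<n⊓o⇒m<n (part μ a) (part ν a) p , m<n⊓o⇒m<o (part μ a) (part ν a) p)
  (λ (p , q) → ⊓-pres-m< p q)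

_≟ₚ_ : DecidableEquality Position
_≟ₚ_ = ≡-dec _≟_ _≟_

-- Adding x to μ and removing x from ν are one relation, so both operators share the lemmas below.
-- Only diagrams are compared, since a partition has several representatives.
record Adds (x : Position) (μ ν : Partition) : Set where
  constructor mkAdds
  field
    x∉μ     : x ∉ μ
    diagram : ∀ y → y ∈ ν ⇔ (y ∈ μ ⊎ y ≡ x)

module _ {x : Position} {μ ν : Partition} (adds : Adds x μ ν) where

  open Adds adds

  Adds⇒∈ : x ∈ ν
  Adds⇒∈ = Equivalence.from (diagram x) (inj₂ refl)

  Adds⇒⊆ : ∀ y → y ∈ μ → y ∈ ν
  Adds⇒⊆ _ y∈μ = Equivalence.from (diagram _) (inj₁ y∈μ)

  Adds⇒⊇ : ∀ y → y ∈ ν → y ≢ x → y ∈ μ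
  Adds⇒⊇ _ y∈ν y≢x = [ id , ⊥-elim ∘ y≢x ] (Equivalence.to (diagram _) y∈ν)

  Adds⇒Addable : Addable μ x
  Adds⇒Addable = x∉μ , ν , diagram

  Adds⇒Removable : Removable ν x
  Adds⇒Removable = Adds⇒∈ , μ , λ y → mk⇔
    (λ y∈μ → Adds⇒⊆ y y∈μ , λ { refl → x∉μ y∈μ })
    (λ (y∈ν , y≢x) → Adds⇒⊇ y y∈ν y≢x)

  -- If κ is μ with y added, then the union of ν and κ is ν with y added, because μ is contained in
  -- ν.
  addable-after-adding : ∀ {y} → Addable μ y → y ≢ x → Addable ν y
  addable-after-adding {y} (y∉μ , κ , κ-diagram) y≢x =
    (λ y∈ν → y∉μ (Adds⇒⊇ y y∈ν y≢x)) , union ν κ , λ z → mk⇔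
      (λ z∈ → [ inj₁ , Sum.map₁ (Adds⇒⊆ z) ∘ Equivalence.to (κ-diagram z) ]
                (Equivalence.to (∈-union ν κ z) z∈))
      (λ z∈ → Equivalence.from (∈-union ν κ z)
                (Sum.map₂ (Equivalence.from (κ-diagram z) ∘ inj₂) z∈))

  -- If κ is ν with y removed, then the intersection of μ and κ is μ with y removed.
  removable-before-adding : ∀ {y} → Removable ν y → y ≢ x → Removable μ y
  removable-before-adding {y} (y∈ν , κ , κ-diagram) y≢x =
    Adds⇒⊇ y y∈ν y≢x , intersection μ κ , λ z → mk⇔
      (λ z∈ → let z∈μ , z∈κ = Equivalence.to (∈-intersection μ κ z) z∈
              in z∈μ , proj₂ (Equivalence.to (κ-diagram z) z∈κ))
      (λ (z∈μ , z≢y) → Equivalence.from (∈-intersection μ κ z)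
        (z∈μ , Equivalence.from (κ-diagram z) (Adds⇒⊆ z z∈μ , z≢y)))

Removable⇒Adds : ∀ {μ x} ((x∈μ , ν , _) : Removable μ x) → Adds x ν μ
Removable⇒Adds {μ} {x} (x∈μ , ν , diagram) =
  mkAdds (λ x∈ν → proj₂ (Equivalence.to (diagram x) x∈ν) refl) λ y → mk⇔
    (split y)
    [ proj₁ ∘ Equivalence.to (diagram y) , (λ { refl → x∈μ }) ]
  where
  split : ∀ y → y ∈ μ → y ∈ ν ⊎ y ≡ x
  split y y∈μ with y ≟ₚ x
  ... | yes y≡x = inj₂ y≡x
  ... | no  y≢x = inj₁ (Equivalence.from (diagram y) (y∈μ , y≢x))

module _ (ℓ : ℕ) .{{_ : NonZero ℓ}} (ℓ≥2 : 2 ≤ ℓ) where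

  -- Adding x can make y addable only if x is the left or the upper neighbour of y, and neighbours
  -- have different residues.
  addable-before-adding :
    ∀ {x μ ν y} → Adds x μ ν → residue ℓ x ≡ residue ℓ y →
    Addable ν y → Addable μ y
  addable-before-adding {x} {μ} {ν} {a , b} adds res≡ add-y
    with addable⇒corner ν (a , b) add-y
  ... | b≡ , above = corner⇒addable μ (a , b)
    ( ≤-antisym (b≤ b b≡ res≡) (≮⇒≥ (proj₁ add-y ∘ Adds⇒⊆ adds (a , b)))
    , above′ a above res≡ )
    where
    -- The left neighbour of y lies in ν and is not x, hence lies in μ. In the first column there is
    -- nothing to check.
    b≤ : ∀ b → b ≡ part ν a → residue ℓ x ≡ residue ℓ (a , b) → b ≤ part μ a
    b≤ zero    _    _    = z≤n
    b≤ (suc b) b+1≡ res≡ = Adds⇒⊇ adds (a , b) (≤-reflexive b+1≡)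
      λ { refl → residue-right ℓ ℓ≥2 a b (sym res≡) }
    above′ : ∀ a → Above ν (a , b) → residue ℓ x ≡ residue ℓ (a , b) →
             Above μ (a , b)
    above′ zero    _ _    = tt
    above′ (suc a) p res≡ = Adds⇒⊇ adds (a , b) p
      λ { refl → residue-below ℓ ℓ≥2 a b res≡ }

-- Counting distinct positions

-- Each position found is excluded from the predicate for the later ones, so the n positions are
-- distinct.
data AtLeast (P : Position → Set) : ℕ → Set where
  none : AtLeast P 0
  some : ∀ {n} x → P x → AtLeast (λ y → P y × y ≢ x) n → AtLeast P (suc n)

AtLeast-map : ∀ {n} {P Q : Position → Set} → (∀ {x} → P x → Q x) →
              AtLeast P n → AtLeast Q n
AtLeast-map f none            = none
AtLeast-map f (some x px pxs) =
  some x (f px) (AtLeast-map (λ (py , y≢x) → f py , y≢x) pxs)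

AtLeast-≤ : ∀ {m n} {P : Position → Set} → m ≤ n → AtLeast P n → AtLeast P m
AtLeast-≤ z≤n       _               = none
AtLeast-≤ (s≤s m≤n) (some x px pxs) = some x px (AtLeast-≤ m≤n pxs)

-- One position is given up: x itself if it is met in time, and otherwise the last one.
AtLeast-remove : ∀ {n} {P : Position → Set} x →
                 AtLeast P n → AtLeast (λ y → P y × y ≢ x) (pred n)
AtLeast-remove {zero}        x _               = none
AtLeast-remove {suc zero}    x _               = none
AtLeast-remove {suc (suc n)} x (some y py pys) with y ≟ₚ x
... | yes refl = pys
... | no  y≢x  = some y (py , y≢x)
  (AtLeast-map (λ ((pz , z≢y) , z≢x) → (pz , z≢x) , z≢y) (AtLeast-remove x pys))

AtLeast-unique : ∀ {A : Set} (f : A → Position) {P : Position → Set} xs →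
                 Unique (map f xs) → All (P ∘ f) xs → AtLeast P (length xs)
AtLeast-unique f []       _               _          = none
AtLeast-unique f (x ∷ xs) (x∉xs ∷ uniq) (px ∷ pxs) =
  some (f x) px (AtLeast-unique f xs uniq
    (All.zip (pxs , All.map (_∘ sym) (All.map⁻ x∉xs))))

-- The reduced signature

position : ∀ {μ} → Letter μ → Position
position (plus x _)  = x
position (minus x _) = x

-- Each ladder is filtered from a window without repetitions, and two ladders are disjoint because a
-- position has only one index. Hence the boxes counted by `φ̂` and `ε̂` are distinct.
readingOrder-unique : ∀ ℓ μ → Unique (readingOrder ℓ μ)
readingOrder-unique ℓ μ = concat⁺
  (All.map⁺ (All.universal
    (λ L → filter⁺ (λ x → ladderIndex ℓ x ≟ L) window-unique) Ls))
  (AllPairs.map⁺ (AllPairs.map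
    (λ {L} {L′} L≢L′ {x} (x∈L , x∈L′) → L≢L′ (trans
      (sym (proj₂ (∈-filter⁻ (λ x → ladderIndex ℓ x ≟ L) {xs = window μ} x∈L)))
      (proj₂ (∈-filter⁻ (λ x → ladderIndex ℓ x ≟ L′) {xs = window μ} x∈L′))))
    (upTo⁺ _)))
  where
  Ls = upTo (suc (ladderIndex ℓ (bound μ , part μ 0)))
  window-unique : Unique (window μ)
  window-unique =
    cartesianProduct⁺ (upTo⁺ (suc (bound μ))) (upTo⁺ (suc (part μ 0)))

AllPairs-resp-⊆ : ∀ {A : Set} {R : A → A → Set} {xs ys} →
                  xs ⊆ ys → AllPairs R ys → AllPairs R xs
AllPairs-resp-⊆ []           []       = []
AllPairs-resp-⊆ (_ ∷ʳ xs⊆)   (_ ∷ ps) = AllPairs-resp-⊆ xs⊆ ps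
AllPairs-resp-⊆ (refl ∷ xs⊆) (p ∷ ps) = All-resp-⊆ xs⊆ p ∷ AllPairs-resp-⊆ xs⊆ ps

-- Cancellation only deletes letters, so distinctness and residues pass to the reduced signature.
reduce-⊆ : ∀ {μ} (w : List (Letter μ)) → reduce w ⊆ w
reduce-⊆ []      = []
reduce-⊆ (s ∷ w) = ⊆-trans (cancel-⊆ s (reduce w)) (refl ∷ reduce-⊆ w)
  where
  cancel-⊆ : ∀ {μ} (s : Letter μ) w → cancel s w ⊆ s ∷ w
  cancel-⊆ (plus _ _)  w                 = ⊆-refl
  cancel-⊆ (minus _ _) []                = ⊆-refl
  cancel-⊆ (minus x p) (plus y q ∷ w)    = minus x p ∷ʳ plus y q ∷ʳ ⊆-refl
  cancel-⊆ (minus _ _) (minus _ _ ∷ _)   = ⊆-refl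

pluses-⊆ : ∀ {μ} (w : List (Letter μ)) → map proj₁ (pluses w) ⊆ map position w
pluses-⊆ []              = []
pluses-⊆ (plus x p  ∷ w) = refl ∷ pluses-⊆ w
pluses-⊆ (minus x p ∷ w) = x ∷ʳ pluses-⊆ w

minuses-⊆ : ∀ {μ} (w : List (Letter μ)) → map proj₁ (minuses w) ⊆ map position w
minuses-⊆ []              = []
minuses-⊆ (plus x p  ∷ w) = x ∷ʳ minuses-⊆ w
minuses-⊆ (minus x p ∷ w) = refl ∷ minuses-⊆ w

module _ (ℓ : ℕ) .{{_ : NonZero ℓ}} (i : ℕ) (μ : Partition) where

  letter-position : ∀ x → MaybeAll.All (λ s → x ≡ position s × residue ℓ x ≡ i)
                                       (letter ℓ i μ x)
  letter-position x with residue ℓ x ≟ i | addable? μ x | removable? μ x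
  ... | no _  | _     | _     = MaybeAll.nothing
  ... | yes e | yes _ | _     = MaybeAll.just (refl , e)
  ... | yes e | no _  | yes _ = MaybeAll.just (refl , e)
  ... | yes _ | no _  | no _  = MaybeAll.nothing

  letters-⊆ : ∀ xs → map position (mapMaybe (letter ℓ i μ) xs) ⊆ xs
  letters-⊆ []       = []
  letters-⊆ (x ∷ xs) with letter ℓ i μ x | letter-position x
  ... | nothing | _                       = x ∷ʳ letters-⊆ xs
  ... | just s  | MaybeAll.just (x≡s , _) = sym x≡s ∷ letters-⊆ xs

  letters-residue : ∀ xs → All (λ s → residue ℓ (position s) ≡ i)
                               (mapMaybe (letter ℓ i μ) xs)
  letters-residue []       = []
  letters-residue (x ∷ xs) with letter ℓ i μ x | letter-position x
  ... | nothing | _                           = letters-residue xs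
  ... | just s  | MaybeAll.just (refl , res≡) = res≡ ∷ letters-residue xs

  reduced-unique : Unique (map position (reducedSignature ℓ i μ))
  reduced-unique = AllPairs-resp-⊆
    (⊆-trans (map⁺ position (reduce-⊆ (signature ℓ i μ)))
      (letters-⊆ (readingOrder ℓ μ)))
    (readingOrder-unique ℓ μ)

  reduced-residue : All (λ x → residue ℓ x ≡ i)
                        (map position (reducedSignature ℓ i μ))
  reduced-residue = All.map⁺ (All-resp-⊆ (reduce-⊆ (signature ℓ i μ))
    (letters-residue (readingOrder ℓ μ)))

  pluses-residue : All (λ (x , _) → residue ℓ x ≡ i)
                       (pluses (reducedSignature ℓ i μ))
  pluses-residue = All.map⁻
    (All-resp-⊆ (pluses-⊆ (reducedSignature ℓ i μ)) reduced-residue)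

  minuses-residue : All (λ (x , _) → residue ℓ x ≡ i)
                        (minuses (reducedSignature ℓ i μ))
  minuses-residue = All.map⁻
    (All-resp-⊆ (minuses-⊆ (reducedSignature ℓ i μ)) reduced-residue)

  -- The claim holds for every remaining plus, hence for the one that `f̂` selects.
  f̂-adds : MaybeAll.All (λ ν → ∃[ x ] residue ℓ x ≡ i × Adds x μ ν) (f̂ ℓ i μ)
  f̂-adds = MaybeAll.map⁺ (All.last⁺ (All.map
    (λ { {x , x∉μ , ν , diagram} res≡ → x , res≡ , mkAdds x∉μ diagram })
    pluses-residue))

  ê-adds : MaybeAll.All (λ ν → ∃[ x ] residue ℓ x ≡ i × Adds x ν μ) (ê ℓ i μ)
  ê-adds = MaybeAll.map⁺ (All.head⁺ (All.map
    (λ { {x , rem-x} res≡ → x , res≡ , Removable⇒Adds rem-x })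
    minuses-residue))

-- Powers of the crystal operators

power-invariant :
  ∀ (g : Partition → Maybe Partition) (Inv : ℕ → Partition → Set) →
  (∀ k {ν} → Inv k ν → MaybeAll.All (Inv (suc k)) (g ν)) →
  ∀ {μ} → Inv 0 μ → ∀ k → MaybeAll.All (Inv k) (power g k μ)
power-invariant g Inv step     inv₀ zero    = MaybeAll.just inv₀
power-invariant g Inv step {μ} inv₀ (suc k)
  with power g k μ | power-invariant g Inv step inv₀ k
-- A power that is 0 stays 0, and there the invariant is vacuous.
... | nothing | _                 = MaybeAll.nothing
... | just ν  | MaybeAll.just inv = step k inv

module _ (ℓ : ℕ) .{{_ : NonZero ℓ}} (ℓ≥2 : 2 ≤ ℓ) (i : ℕ) (μ : Partition) where

  private
    Add Rem : Partition → Position → Set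
    Add = AddableI ℓ i
    Rem = RemovableI ℓ i

  many-addable : AtLeast (Add μ) (φ̂ ℓ i μ)
  many-addable = AtLeast-unique proj₁ (pluses (reducedSignature ℓ i μ))
    (AllPairs-resp-⊆ (pluses-⊆ (reducedSignature ℓ i μ)) (reduced-unique ℓ i μ))
    (All.map (λ { {_ , add} res≡ → add , res≡ }) (pluses-residue ℓ i μ))

  many-removable : AtLeast (Rem μ) (ε̂ ℓ i μ)
  many-removable = AtLeast-unique proj₁ (minuses (reducedSignature ℓ i μ))
    (AllPairs-resp-⊆ (minuses-⊆ (reducedSignature ℓ i μ)) (reduced-unique ℓ i μ))
    (All.map (λ { {_ , rem} res≡ → rem , res≡ }) (minuses-residue ℓ i μ))

  -- Each step uses up at most one of the addable boxes, and the others stay addable. The removable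
  -- box is always the one just added, which exists only for k > 0.
  f̂-power : ∀ k → MaybeAll.All
    (λ ν → AtLeast (Add ν) (φ̂ ℓ i μ ∸ k) × (0 < k → ∃ (Rem ν)))
    (power (f̂ ℓ i) k μ)
  f̂-power = power-invariant (f̂ ℓ i)
    (λ k ν → AtLeast (Add ν) (φ̂ ℓ i μ ∸ k) × (0 < k → ∃ (Rem ν)))
    (λ k {ν} (adds , _) → MaybeAll.map
      (λ (x , res≡ , adds-x) →
        AtLeast-map
          (λ ((add , res) , ≢x) → addable-after-adding adds-x add ≢x , res)
          (subst (AtLeast _) (pred[m∸n]≡m∸[1+n] (φ̂ ℓ i μ) k)
            (AtLeast-remove x adds))
        , λ _ → x , Adds⇒Removable adds-x , res≡)
      (f̂-adds ℓ i ν))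
    (many-addable , λ ())

  -- Each step turns the removed box into an addable one. Those removed earlier stay addable because
  -- all share the residue i, and at most one removable box is lost.
  ê-power : ∀ k → MaybeAll.All
    (λ ν → AtLeast (Add ν) k × AtLeast (Rem ν) (ε̂ ℓ i μ ∸ k))
    (power (ê ℓ i) k μ)
  ê-power = power-invariant (ê ℓ i)
    (λ k ν → AtLeast (Add ν) k × AtLeast (Rem ν) (ε̂ ℓ i μ ∸ k))
    (λ k {ν} (adds , rems) → MaybeAll.map
      (λ (x , res≡ , adds-x) →
        (some x (Adds⇒Addable adds-x , res≡) (AtLeast-map
          (λ (add , res) →
            (addable-before-adding ℓ ℓ≥2 adds-x (trans res≡ (sym res)) add , res)
            -- The earlier addable positions lie outside ν, while x lies in ν until this step.
            , λ { refl → proj₁ add (Adds⇒∈ adds-x) })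
          adds))
        , AtLeast-map
            (λ ((rem , res) , ≢x) → removable-before-adding adds-x rem ≢x , res)
            (subst (AtLeast _) (pred[m∸n]≡m∸[1+n] (ε̂ ℓ i μ) k)
              (AtLeast-remove x rems)))
      (ê-adds ℓ i ν))
    (none , many-removable)

  not-JM : ∀ ν → AtLeast (Add ν) 2 → ∃ (Rem ν) → ¬ JM ℓ ν
  not-JM ν (some p add-p (some q (add-q , q≢p) none)) (r , rem-r) =
    two-addable-one-removable⇒¬JM ℓ ℓ≥2 i ν add-p add-q q≢p rem-r

  f̂-power-not-JM : ∀ k → 0 < k → k < φ̂ ℓ i μ ∸ 1 →
                   MaybeAll.All (¬_ ∘ JM ℓ) (power (f̂ ℓ i) k μ)
  f̂-power-not-JM k 0<k k<φ∸1 = MaybeAll.map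
    (λ {ν} (adds , rem) →
      not-JM ν (AtLeast-≤ (two-left (φ̂ ℓ i μ) k<φ∸1) adds) (rem 0<k))
    (f̂-power k)
    where
    -- The bound k < n - 1 says k + 2 ≤ n, which leaves the two addable boxes required. For n = 0 it
    -- is absurd.
    two-left : ∀ n → k < n ∸ 1 → 2 ≤ n ∸ k
    two-left (suc n) k<n =
      subst (2 ≤_) (sym (+-∸-assoc 1 (<⇒≤ k<n))) (s≤s (m<n⇒0<n∸m k<n))

  ê-power-not-JM : ∀ k → 1 < k → k < ε̂ ℓ i μ →
                   MaybeAll.All (¬_ ∘ JM ℓ) (power (ê ℓ i) k μ)
  ê-power-not-JM k 1<k k<ε = MaybeAll.map
    (λ {ν} (adds , rems) →
      not-JM ν (AtLeast-≤ 1<k adds) (one (AtLeast-≤ (m<n⇒0<n∸m k<ε) rems)))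
    (ê-power k)
    where
    one : ∀ {P : Position → Set} → AtLeast P 1 → ∃ P
    one (some x px none) = x , px

-- `Any` has no proof at `nothing`, so a power equal to 0 counts as not being a JM partition.
All¬⇒¬Any : ∀ {P : Partition → Set} {m} → MaybeAll.All (¬_ ∘ P) m → ¬ Any P m
All¬⇒¬Any (MaybeAll.just ¬p) (MaybeAny.just p) = ¬p p

theorem3p7p3p2 : (ℓ : ℕ) .{{_ : NonZero ℓ}} → ℓ ≥ 3 →
    (μ : Partition) → JM ℓ μ →
    (i : ℕ) → i < ℓ →
    (∀ k → 0 < k → k < φ̂ ℓ i μ ∸ 1 → ¬ Any (JM ℓ) (power (f̂ ℓ i) k μ))
    × (∀ k → 1 < k → k < ε̂ ℓ i μ → ¬ Any (JM ℓ) (power (ê ℓ i) k μ))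
theorem3p7p3p2 ℓ ℓ≥3 μ _ i _ =
  (λ k 0<k k<φ∸1 → All¬⇒¬Any (f̂-power-not-JM ℓ (<⇒≤ ℓ≥3) i μ k 0<k k<φ∸1)) ,
  (λ k 1<k k<ε   → All¬⇒¬Any (ê-power-not-JM ℓ (<⇒≤ ℓ≥3) i μ k 1<k k<ε))
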